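{- Let $m\ge 1$ and $3\le a_1\le a_2\le\cdots\le a_m<n$ be integers with $\sum_{i=1}^m a_i=n$. Then $$\eta(K_{a_1,a_2,\dots,a_m})=\begin{cases} 2n-a_1+3, & n-a_1 \text{ even},\\ 2n-a_1+2, & n-a_1 \text{ odd.}\end{cases}$$
   Context: $K_{a_1,\dots,a_m}$ denotes the complete multipartite graph with parts of sizes $a_1,\dots,a_m$. A configuration $C$ on a graph $G$ is a function $C:V(G)\to\mathbb{Z}_{\ge 0}$ ($C(v)$ is the number of pebbles on $v$); its size is $\sum_{v}C(v)$. A pebbling move removes two pebbles from a vertex and places one pebble on an adjacent vertex. The Two-Player Pebbling Game on $G$ with root $r$ and starting configuration $C$ is played by Mover and Defender in rounds: in each round Mover makes a pebbling move and then Defender makes a pebbling move; each player must take their turn. If Mover pebbles from $u$ to $v$, Defender may not pebble from $v$ to $u$ in the same round. Mover wins if at any time the root has at least one pebble; Defender wins if the root has no pebble and there are no more pebbling moves. A winning strategy for a player is a rule choosing that player's moves as a function of the current position which guarantees that player wins. The rooted two-player pebbling number $\eta(G,r)$ is the minimum $m$ such that for every configuration of $m$ pebbles Mover has a winning strategy; if for arbitrarily large $m$ there is a configuration of size greater than $m$ on which Defender has a winning strategy, then $\eta(G,r)=\infty$. The two-player pebbling number is $\eta(G)=\max_{r\in V(G)}\eta(G,r)$ (equal to $\infty$ if some $\eta(G,r)=\infty$). -}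

module Defs where

open import Data.Nat using (ℕ; zero; suc; _+_; _*_; _∸_; _≤_; _<_)
open import Data.Nat.Divisibility using (_∣_)
open import Data.Fin using (Fin)
import Data.Fin.Properties as FinP
open import Data.Vec using (Vec; lookup; tabulate; sum; head; last)
open import Data.Product using (Σ; Σ-syntax; ∃; ∃-syntax; _×_; _,_)
open import Data.Product.Properties using (≡-dec)
open import Data.Bool using (if_then_else_)
open import Relation.Nullary using (¬_; Dec; yes; no)
open import Relation.Nullary.Decidable using (⌊_⌋)
open import Relation.Binary.PropositionalEquality using (_≡_)

Vertex : ∀ {m} → Vec ℕ m → Set
Vertex {m} a = Σ (Fin m) (λ i → Fin (lookup a i))

Adj : ∀ {m} (a : Vec ℕ m) → Vertex a → Vertex a → Set
Adj a (i , _) (i' , _) = ¬ (i ≡ i')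

decV : ∀ {m} (a : Vec ℕ m) (x y : Vertex a) → Dec (x ≡ y)
decV a = ≡-dec FinP._≟_ FinP._≟_

Config : ∀ {m} → Vec ℕ m → Set
Config a = Vertex a → ℕ

size : ∀ {m} (a : Vec ℕ m) → Config a → ℕ
size a C = sum (tabulate (λ i → sum (tabulate (λ j → C (i , j)))))

pebble : ∀ {m} (a : Vec ℕ m) → Config a → Vertex a → Vertex a → Config a
pebble a C u v x =
  (C x ∸ (if ⌊ decV a x u ⌋ then 2 else 0)) + (if ⌊ decV a x v ⌋ then 1 else 0)

CanMove : ∀ {m} (a : Vec ℕ m) → Config a → Vertex a → Vertex a → Set
CanMove a C u v = Adj a u v × 2 ≤ C u

-- The two-player pebbling game with root r.
-- MoverTurn a r C : Mover (to move at configuration C) can force a win.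
-- AfterMover a r u v C : after Mover's move u → v producing C, with
--   Defender to move (and forbidden to pebble v → u this round),
--   Mover can force a win.
-- Since every move decreases the number of pebbles, the game is finite and
-- these inductive predicates say exactly that Mover has a winning strategy
-- (a rule choosing moves as a function of the position).

mutual
  data MoverTurn {m} (a : Vec ℕ m) (r : Vertex a) (C : Config a) : Set where
    rootM : 1 ≤ C r → MoverTurn a r C
    moveM : (u v : Vertex a) → CanMove a C u v →
            AfterMover a r u v (pebble a C u v) → MoverTurn a r C

  data AfterMover {m} (a : Vec ℕ m) (r : Vertex a) (u v : Vertex a)
                  (C : Config a) : Set where
    rootD : 1 ≤ C r → AfterMover a r u v C
    -- The game is not over (some pebbling move exists), and every legal
    -- Defender move leads to a position from which Mover wins.
    allD  : (∃[ x ] ∃[ y ] CanMove a C x y) →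
            ((x y : Vertex a) → CanMove a C x y → ¬ (x ≡ v × y ≡ u) →
               MoverTurn a r (pebble a C x y)) →
            AfterMover a r u v C

MoverWins : ∀ {m} (a : Vec ℕ m) → Vertex a → Config a → Set
MoverWins a r C = MoverTurn a r C

-- η(K_a , r) = k  (finite value), following the paper's definition:
-- k is the minimum number such that Mover wins on every configuration of
-- exactly k pebbles, and η(K_a , r) is not ∞ (Defender does not win on
-- configurations of arbitrarily large size).
EtaRootIs : ∀ {m} (a : Vec ℕ m) → Vertex a → ℕ → Set
EtaRootIs a r k =
  ((C : Config a) → size a C ≡ k → MoverWins a r C) ×
  ((j : ℕ) → j < k → ∃[ C ] (size a C ≡ j × ¬ MoverWins a r C)) ×
  (∃[ B ] ((C : Config a) → B ≤ size a C → MoverWins a r C))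

EtaIs : ∀ {m} (a : Vec ℕ m) → ℕ → Set
EtaIs a k =
  ((r : Vertex a) → ∃[ k' ] (k' ≤ k × EtaRootIs a r k')) ×
  (∃[ r ] EtaRootIs a r k)

Sorted : ∀ {m} → Vec ℕ m → Set
Sorted {m} a = (i j : Fin m) → i Data.Fin.≤ j → lookup a i ≤ lookup a j

{-# OPTIONS --safe #-}

-- Fix a root r in a part of size p, and let N = n − p.  Mover wins at once if r is
-- pebbled or a vertex outside its part carries two pebbles.  Otherwise the game is
-- governed by e, the number of empty vertices outside the part of r, and by
-- M = Σ ⌊C(x)/2⌋ over the part of r, the moves still stored there.  A move from the
-- part of r to an empty vertex decreases both by one; a move to an occupied vertex
-- threatens r, and Defender answers by carrying that pebble back into the part of r
-- (the only answer when e = 0).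
-- Both players fill empty vertices as long as possible, which turns the game into a
-- fight for parity: for odd e Mover wins iff M ≥ e + 1, for even e he wins if
-- M ≥ e + 3 and loses if M ≤ e + 1.  In the borderline case M = e + 2 with e even,
-- Mover wins if all non-root vertices of the part carry odd numbers, since a pebble
-- carried back then completes a new pair, and Defender wins if one of them is empty.
-- Counting gives |C| + e + 1 ≤ 2M + n with e ≤ N, whence the thresholds.
module Submission where

open import Defs
open import Data.Nat using (ℕ; zero; suc; _+_; _*_; _∸_; _≤_; _<_; z≤n; s≤s; s≤s⁻¹; ⌊_/2⌋; parity)
open import Data.Nat.Divisibility using (_∣_; divides)
open import Data.Nat.Properties
open import Data.Nat.Tactic.RingSolver using (solve-∀)
open import Data.Bool using (if_then_else_)
open import Data.Empty using (⊥)
open import Data.Fin using (Fin; zero; suc; fromℕ; fromℕ<)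
import Data.Fin.Properties as FinP
open import Data.Parity.Base using (0ℙ; 1ℙ)
open import Data.Parity.Properties using () renaming (_≟_ to _≟ᴾ_)
open import Data.Product using (_×_; _,_; proj₁; proj₂; ∃-syntax)
open import Data.Sum using (_⊎_; inj₁; inj₂)
open import Data.Vec using (Vec; []; _∷_; sum; head; last; lookup; tabulate)
open import Data.Vec.Properties using (tabulate-cong; tabulate∘lookup)
open import Function using (_∘_)
open import Relation.Nullary using (¬_; Dec; yes; no; contradiction)
open import Relation.Nullary.Decidable using (⌊_⌋; map′; ¬?; _×-dec_)
open import Relation.Unary using (Decidable)
open import Relation.Binary.PropositionalEquality

-- Halving, parity and conditionals on decisions.

private variable
  A P : Set
  n : ℕ

if-yes : (d : Dec P) {x y : A} → P → (if ⌊ d ⌋ then x else y) ≡ x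
if-yes (yes _) _ = refl
if-yes (no ¬p) p = contradiction p ¬p

if-no : (d : Dec P) {x y : A} → ¬ P → (if ⌊ d ⌋ then x else y) ≡ y
if-no (yes p) ¬p = contradiction p ¬p
if-no (no _)  _  = refl

-- One more pebble completes a pair exactly on an odd pile. This decides whether a pebble carried
-- back into the root's part restores a tempo.
⌊1+n/2⌋-cases : ∀ n → (parity n ≡ 0ℙ × ⌊ suc n /2⌋ ≡ ⌊ n /2⌋)
                    ⊎ (parity n ≡ 1ℙ × ⌊ suc n /2⌋ ≡ 1 + ⌊ n /2⌋)
⌊1+n/2⌋-cases zero          = inj₁ (refl , refl)
⌊1+n/2⌋-cases (suc zero)    = inj₂ (refl , refl)
⌊1+n/2⌋-cases (suc (suc n)) with ⌊1+n/2⌋-cases n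
... | inj₁ (p , q) = inj₁ (p , cong suc q)
... | inj₂ (p , q) = inj₂ (p , cong suc q)

n≤1+2⌊n/2⌋ : ∀ n → n ≤ 1 + (⌊ n /2⌋ + ⌊ n /2⌋)
n≤1+2⌊n/2⌋ zero          = z≤n
n≤1+2⌊n/2⌋ (suc zero)    = s≤s z≤n
n≤1+2⌊n/2⌋ (suc (suc n)) =
  subst (λ k → 2 + n ≤ 2 + k) (sym (+-suc ⌊ n /2⌋ ⌊ n /2⌋)) (s≤s (s≤s (n≤1+2⌊n/2⌋ n)))

even⇒n≤2⌊n/2⌋ : ∀ n → parity n ≡ 0ℙ → n ≤ ⌊ n /2⌋ + ⌊ n /2⌋
even⇒n≤2⌊n/2⌋ zero          _ = z≤n
even⇒n≤2⌊n/2⌋ (suc (suc n)) p =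
  subst (λ k → 2 + n ≤ suc k) (sym (+-suc ⌊ n /2⌋ ⌊ n /2⌋)) (s≤s (s≤s (even⇒n≤2⌊n/2⌋ n p)))

1≤⌊n/2⌋⇒2≤n : ∀ n → 1 ≤ ⌊ n /2⌋ → 2 ≤ n
1≤⌊n/2⌋⇒2≤n (suc (suc n)) _ = s≤s (s≤s z≤n)

even-or-odd : ∀ n → (∃[ h ] n ≡ h + h) ⊎ (∃[ h ] n ≡ suc (h + h))
even-or-odd zero    = inj₁ (0 , refl)
even-or-odd (suc n) with even-or-odd n
... | inj₁ (h , p) = inj₂ (h , cong suc p)
... | inj₂ (h , p) = inj₁ (suc h , cong suc (trans p (sym (+-suc h h))))

double-cancel-< : ∀ {m n} → m + m < n + n → m < n
double-cancel-< {m} {n} p = ≰⇒> λ n≤m → <⇒≱ p (+-mono-≤ n≤m n≤m)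

≤1-cases : n ≤ 1 → n ≡ 0 ⊎ n ≡ 1
≤1-cases z≤n       = inj₁ refl
≤1-cases (s≤s z≤n) = inj₂ refl

-- With three vertices in a part, Defender finds a place to retreat to that is neither the root nor
-- the vertex Mover has just left.
fresh : 3 ≤ n → (p q : Fin n) → ∃[ s ] (s ≢ p × s ≢ q)
fresh (s≤s (s≤s (s≤s _))) zero          zero          = suc zero , (λ ()) , (λ ())
fresh (s≤s (s≤s (s≤s _))) zero          (suc zero)    = suc (suc zero) , (λ ()) , (λ ())
fresh (s≤s (s≤s (s≤s _))) zero          (suc (suc q)) = suc zero , (λ ()) , (λ ())
fresh (s≤s (s≤s (s≤s _))) (suc zero)    zero          = suc (suc zero) , (λ ()) , (λ ())
fresh (s≤s (s≤s (s≤s _))) (suc zero)    (suc q)       = zero , (λ ()) , (λ ())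
fresh (s≤s (s≤s (s≤s _))) (suc (suc p)) zero          = suc zero , (λ ()) , (λ ())
fresh (s≤s (s≤s (s≤s _))) (suc (suc p)) (suc q)       = zero , (λ ()) , (λ ())

-- Finite sums

sumFin : (Fin n → ℕ) → ℕ
sumFin f = sum (tabulate f)

sumFin-cong : {f g : Fin n → ℕ} → (∀ i → f i ≡ g i) → sumFin f ≡ sumFin g
sumFin-cong = cong sum ∘ tabulate-cong

sumFin-mono : {f g : Fin n → ℕ} → (∀ i → f i ≤ g i) → sumFin f ≤ sumFin g
sumFin-mono {zero}  p = z≤n
sumFin-mono {suc n} p = +-mono-≤ (p zero) (sumFin-mono (p ∘ suc))

sumFin-+ : (f g : Fin n → ℕ) → sumFin (λ i → f i + g i) ≡ sumFin f + sumFin g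
sumFin-+ {zero}  f g = refl
sumFin-+ {suc n} f g = trans (cong (f zero + g zero +_) (sumFin-+ (f ∘ suc) (g ∘ suc)))
  (shuffle (f zero) (g zero) (sumFin (f ∘ suc)) (sumFin (g ∘ suc)))
  where
  shuffle : ∀ x y s t → x + y + (s + t) ≡ x + s + (y + t)
  shuffle = solve-∀

sumFin-zero : ∀ n → sumFin {n} (λ _ → 0) ≡ 0
sumFin-zero zero    = refl
sumFin-zero (suc n) = sumFin-zero n

sumFin-one : ∀ n → sumFin {n} (λ _ → 1) ≡ n
sumFin-one zero    = refl
sumFin-one (suc n) = cong suc (sumFin-one n)

-- A move between the root's part and its complement changes each count at a single vertex. Writing
-- the change as an added `d` avoids truncated subtraction.
sumFin-at : {f g : Fin n → ℕ} (i : Fin n) (d : ℕ) → f i ≡ d + g i →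
  (∀ j → j ≢ i → f j ≡ g j) → sumFin f ≡ d + sumFin g
sumFin-at {suc n} {f} {g} zero d p q =
  trans (cong₂ _+_ p (sumFin-cong λ j → q (suc j) λ ())) (+-assoc d (g zero) _)
sumFin-at {suc n} {f} {g} (suc i) d p q =
  trans (cong₂ _+_ (q zero λ ())
                   (sumFin-at i d p λ j j≢i → q (suc j) (j≢i ∘ FinP.suc-injective)))
        (shuffle (g zero) d (sumFin (g ∘ suc)))
  where
  shuffle : ∀ x d s → x + (d + s) ≡ d + (x + s)
  shuffle = solve-∀

sumFin-positive : (f : Fin n → ℕ) → 1 ≤ sumFin f → ∃[ i ] 1 ≤ f i
sumFin-positive {suc n} f p with f zero in eq
... | suc k = zero , subst (1 ≤_) (sym eq) (s≤s z≤n)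
... | zero with i , q ← sumFin-positive (f ∘ suc) p = suc i , q

-- Lets one large losing configuration be thinned to every smaller size. Greedy: an entry is emptied
-- before any later one is touched.
sumFin-shrink : (f : Fin n → ℕ) (s : ℕ) → s ≤ sumFin f →
  ∃[ g ] ((∀ i → g i ≤ f i) × sumFin g ≡ s)
sumFin-shrink {zero} f zero p = f , (λ i → ≤-refl) , refl
sumFin-shrink {suc n} f s p with ≤-total s (sumFin (f ∘ suc))
... | inj₁ q with g , g≤f , eq ← sumFin-shrink (f ∘ suc) s q =
  (λ { zero → 0 ; (suc i) → g i }) , (λ { zero → z≤n ; (suc i) → g≤f i }) , eq
... | inj₂ q =
  (λ { zero → s ∸ sumFin (f ∘ suc) ; (suc i) → f (suc i) }) ,
  (λ { zero → m≤n+o⇒m∸n≤o s (sumFin (f ∘ suc)) (subst (s ≤_) (+-comm (f zero) _) p)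
     ; (suc i) → ≤-refl }) ,
  m∸n+n≡m q

-- Sizes of configurations and the effect of a move.

module Sizes {m : ℕ} (a : Vec ℕ m) where

  size-cong : {C D : Config a} → (∀ x → C x ≡ D x) → size a C ≡ size a D
  size-cong p = sumFin-cong λ i → sumFin-cong λ j → p (i , j)

  size-mono : {C D : Config a} → (∀ x → C x ≤ D x) → size a C ≤ size a D
  size-mono p = sumFin-mono λ i → sumFin-mono λ j → p (i , j)

  size-+ : (C D : Config a) → size a (λ x → C x + D x) ≡ size a C + size a D
  size-+ C D = trans (sumFin-cong λ i → sumFin-+ (λ j → C (i , j)) (λ j → D (i , j)))
                     (sumFin-+ (λ i → sumFin λ j → C (i , j)) (λ i → sumFin λ j → D (i , j)))

  size-zero : size a (λ _ → 0) ≡ 0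
  size-zero = trans (sumFin-cong λ i → sumFin-zero (lookup a i)) (sumFin-zero m)

  size-one : size a (λ _ → 1) ≡ sum a
  size-one = trans (sumFin-cong λ i → sumFin-one (lookup a i))
                   (cong sum (tabulate∘lookup a))

  size-at : {C D : Config a} (u : Vertex a) (d : ℕ) → C u ≡ d + D u →
    (∀ x → x ≢ u → C x ≡ D x) → size a C ≡ d + size a D
  size-at (i , j) d p q =
    sumFin-at i d
      (sumFin-at j d p λ j' j'≢j → q (i , j') λ { refl → j'≢j refl })
      (λ i' i'≢i → sumFin-cong λ j' → q (i' , j') λ { refl → i'≢i refl })

  size-positive : (C : Config a) → 1 ≤ size a C → ∃[ x ] 1 ≤ C x
  size-positive C p with i , q ← sumFin-positive (λ i → sumFin λ j → C (i , j)) p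
    with j , s ← sumFin-positive (λ j → C (i , j)) q = (i , j) , s

  size-shrink : (C : Config a) (s : ℕ) → s ≤ size a C →
    ∃[ D ] ((∀ x → D x ≤ C x) × size a D ≡ s)
  size-shrink C s p with g , g≤ , eq ← sumFin-shrink (λ i → sumFin λ j → C (i , j)) s p =
    (λ (i , j) → proj₁ (inner i) j) ,
    (λ (i , j) → proj₁ (proj₂ (inner i)) j) ,
    trans (sumFin-cong λ i → proj₂ (proj₂ (inner i))) eq
    where
    inner : ∀ i → ∃[ h ] ((∀ j → h j ≤ C (i , j)) × sumFin h ≡ g i)
    inner i = sumFin-shrink (λ j → C (i , j)) (g i) (g≤ i)

  point : Vertex a → ℕ → Config a
  point u c x = if ⌊ decV a x u ⌋ then c else 0

  point-self : ∀ u c → point u c u ≡ c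
  point-self u c = if-yes (decV a u u) refl

  point-other : ∀ {u x} c → x ≢ u → point u c x ≡ 0
  point-other c = if-no (decV a _ _)

  size-point : ∀ u c → size a (point u c) ≡ c
  size-point u c = trans
    (size-at u c (trans (point-self u c) (sym (+-identityʳ c))) λ x → point-other c)
    (trans (cong (c +_) size-zero) (+-identityʳ c))

  size-part : ∀ i → size a (λ x → if ⌊ proj₁ x FinP.≟ i ⌋ then 1 else 0) ≡ lookup a i
  size-part i = trans
    (sumFin-at {g = λ _ → 0} i (lookup a i)
      (trans (sumFin-cong {lookup a i} λ j → if-yes (i FinP.≟ i) refl)
             (trans (sumFin-one (lookup a i)) (sym (+-identityʳ _))))
      (λ i' i'≢i → trans (sumFin-cong {lookup a i'} λ j → if-no (i' FinP.≟ i) i'≢i)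
                         (sumFin-zero (lookup a i'))))
    (trans (cong (lookup a i +_) (sumFin-zero m)) (+-identityʳ _))

  term≤size : ∀ C u → C u ≤ size a C
  term≤size C u = subst (_≤ size a C) (size-point u (C u)) (size-mono λ x → bound x (decV a x u))
    where
    bound : ∀ x → Dec (x ≡ u) → point u (C u) x ≤ C x
    bound x (yes refl) = ≤-reflexive (point-self u (C u))
    bound x (no x≢u)   = subst (_≤ C x) (sym (point-other (C u) x≢u)) z≤n

  any-vertex? : {P : Vertex a → Set} → Decidable P → Dec (∃[ x ] P x)
  any-vertex? P? = map′ (λ (i , j , p) → (i , j) , p) (λ ((i , j) , p) → i , j , p)
    (FinP.any? λ i → FinP.any? λ j → P? (i , j))

  -- `pebble` is written with truncated subtraction and decisions; these equations describe a legal
  -- move without either.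
  record Step (u v : Vertex a) (C C' : Config a) : Set where
    field
      src   : C u ≡ 2 + C' u
      dst   : C' v ≡ suc (C v)
      other : ∀ {x} → x ≢ u → x ≢ v → C' x ≡ C x

  pebble-step : ∀ C u v → CanMove a C u v → Step u v C (pebble a C u v)
  pebble-step C u v (u~v , 2≤Cu) = record
    { src   = trans (sym (m+[n∸m]≡n 2≤Cu)) (cong (2 +_) (sym (trans
                (cong₂ (λ s t → C u ∸ s + t) (point-self u 2) (point-other 1 u≢v))
                (+-identityʳ _))))
    ; dst   = trans (cong₂ (λ s t → C v ∸ s + t) (point-other 2 (u≢v ∘ sym)) (point-self v 1))
                    (+-comm (C v) 1)
    ; other = λ {x} x≢u x≢v → trans
                (cong₂ (λ s t → C x ∸ s + t) (point-other 2 x≢u) (point-other 1 x≢v))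
                (+-identityʳ (C x))
    }
    where
    u≢v : u ≢ v
    u≢v = u~v ∘ cong proj₁

-- The game with a fixed root

module Game {m : ℕ} (a : Vec ℕ m) (r : Vertex a) where
  open Sizes a

  -- A record rather than a bare equation, so that x can be inferred from Own x.
  record Own (x : Vertex a) : Set where
    constructor own
    field same-part : proj₁ x ≡ proj₁ r
  open Own

  own? : Decidable Own
  own? x = map′ own same-part (proj₁ x FinP.≟ proj₁ r)

  own-part : Config a
  own-part x = if ⌊ proj₁ x FinP.≟ proj₁ r ⌋ then 1 else 0

  -- Outside the root's part `1 ∸ C x` is the indicator of emptiness. The total of `vacancy` is the
  -- e of the strategy, the total of `pairs` its M.
  vacancy : Config a → Config a
  vacancy C x = if ⌊ own? x ⌋ then 0 else 1 ∸ C x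

  pairs : Config a → Config a
  pairs C x = if ⌊ own? x ⌋ then ⌊ C x /2⌋ else 0

  vacancies : Config a → ℕ
  vacancies C = size a (vacancy C)

  tempi : Config a → ℕ
  tempi C = size a (pairs C)

  own-part-own : ∀ {x} → Own x → own-part x ≡ 1
  own-part-own {x} = if-yes (proj₁ x FinP.≟ proj₁ r) ∘ same-part

  own-part-foreign : ∀ {x} → ¬ Own x → own-part x ≡ 0
  own-part-foreign {x} ¬ox = if-no (proj₁ x FinP.≟ proj₁ r) (¬ox ∘ own)

  vacancy-own : ∀ C {x} → Own x → vacancy C x ≡ 0
  vacancy-own C {x} = if-yes (own? x)

  vacancy-foreign : ∀ C {x} → ¬ Own x → vacancy C x ≡ 1 ∸ C x
  vacancy-foreign C {x} = if-no (own? x)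

  pairs-own : ∀ C {x} → Own x → pairs C x ≡ ⌊ C x /2⌋
  pairs-own C {x} = if-yes (own? x)

  pairs-foreign : ∀ C {x} → ¬ Own x → pairs C x ≡ 0
  pairs-foreign C {x} = if-no (own? x)

  own-to-foreign : ∀ {u v} → Own u → ¬ Own v → Adj a u v
  own-to-foreign ou ¬ov u≡v = ¬ov (own (trans (sym u≡v) (same-part ou)))

  own≢foreign : ∀ {u v} → Own u → ¬ Own v → u ≢ v
  own≢foreign ou ¬ov refl = ¬ov ou

  -- Positions without an immediate win for Mover. Every legal move then starts in the root's part,
  -- since only there can a vertex hold two pebbles.
  record Quiet (C : Config a) : Set where
    field
      root    : C r ≡ 0
      foreign : ∀ {x} → ¬ Own x → C x ≤ 1
  open Quiet
  open Step

  loaded-own : ∀ {C x} → Quiet C → 2 ≤ C x → Own x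
  loaded-own {C} {x} q 2≤Cx with own? x
  ... | yes ox = ox
  ... | no ¬ox = contradiction (foreign q ¬ox) (<⇒≱ 2≤Cx)

  -- A vertex outside the root's part is adjacent to the root, so two pebbles on it reach the root
  -- in one move.
  overfull-wins : ∀ {C v} → ¬ Own v → 2 ≤ C v → MoverTurn a r C
  overfull-wins {C} {v} ¬ov 2≤Cv =
    moveM v r cm (rootD (subst (1 ≤_) (sym (dst (pebble-step C v r cm))) (s≤s z≤n)))
    where
    cm : CanMove a C v r
    cm = (¬ov ∘ own) , 2≤Cv

  wins-or-quiet : ∀ C → MoverTurn a r C ⊎ Quiet C
  wins-or-quiet C with C r in Cr
  ... | suc _ = inj₁ (rootM (subst (1 ≤_) (sym Cr) (s≤s z≤n)))
  ... | zero with any-vertex? (λ x → ¬? (own? x) ×-dec (2 ≤? C x))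
  ...   | yes (v , ¬ov , 2≤Cv) = inj₁ (overfull-wins ¬ov 2≤Cv)
  ...   | no none = inj₂ (record
          { root = Cr ; foreign = λ {x} ¬ox → ≤-pred (≰⇒> λ 2≤Cx → none (x , ¬ox , 2≤Cx)) })

  find-vacant : ∀ {C} → 1 ≤ vacancies C → ∃[ v ] (¬ Own v × C v ≡ 0)
  find-vacant {C} p with v , q ← size-positive (vacancy C) p with own? v
  ... | no ¬ov = v , ¬ov , n<1⇒n≡0 (m∸n≢0⇒n<m λ eq → contradiction (subst (1 ≤_) eq q) λ ())

  find-loaded : ∀ {C} → 1 ≤ tempi C → ∃[ x ] (Own x × 2 ≤ C x)
  find-loaded {C} p with x , q ← size-positive (pairs C) p with own? x
  ... | yes ox = x , ox , 1≤⌊n/2⌋⇒2≤n (C x) q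

  loaded⇒1≤tempi : ∀ {C x} → Own x → 2 ≤ C x → 1 ≤ tempi C
  loaded⇒1≤tempi {C} {x} ox 2≤Cx =
    ≤-trans (subst (1 ≤_) (sym (pairs-own C ox)) (⌊n/2⌋-mono 2≤Cx)) (term≤size (pairs C) x)

  no-vacancies⇒filled : ∀ {C v} → Quiet C → vacancies C ≡ 0 → ¬ Own v → C v ≡ 1
  no-vacancies⇒filled {C} {v} q e≡0 ¬ov with ≤1-cases (foreign q ¬ov)
  ... | inj₂ Cv = Cv
  ... | inj₁ Cv = contradiction
    (subst₂ _≤_ (trans (vacancy-foreign C ¬ov) (cong (1 ∸_) Cv)) e≡0 (term≤size (vacancy C) v))
    λ ()

  -- Changes of tempi and vacancies under a move.

  module _ {C C' : Config a} {u v : Vertex a} (s : Step u v C C') where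

    tempi-outward : Own u → ¬ Own v → tempi C ≡ 1 + tempi C'
    tempi-outward ou ¬ov = size-at u 1
      (trans (pairs-own C ou) (trans (cong ⌊_/2⌋ (src s)) (cong suc (sym (pairs-own C' ou)))))
      λ x x≢u → elsewhere x x≢u (decV a x v)
      where
      elsewhere : ∀ x → x ≢ u → Dec (x ≡ v) → pairs C x ≡ pairs C' x
      elsewhere x x≢u (yes refl) = trans (pairs-foreign C ¬ov) (sym (pairs-foreign C' ¬ov))
      elsewhere x x≢u (no x≢v) =
        cong (λ c → if ⌊ own? x ⌋ then ⌊ c /2⌋ else 0) (sym (other s x≢u x≢v))

    vacancies-outward : Own u → ¬ Own v → vacancies C ≡ (1 ∸ C v) + vacancies C'
    vacancies-outward ou ¬ov = size-at v (1 ∸ C v)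
      (trans (vacancy-foreign C ¬ov) (sym (trans
        (cong (1 ∸ C v +_) (trans (vacancy-foreign C' ¬ov) (trans (cong (1 ∸_) (dst s)) (0∸n≡0 (C v)))))
        (+-identityʳ _))))
      λ x x≢v → elsewhere x x≢v (decV a x u)
      where
      elsewhere : ∀ x → x ≢ v → Dec (x ≡ u) → vacancy C x ≡ vacancy C' x
      elsewhere x x≢v (yes refl) = trans (vacancy-own C ou) (sym (vacancy-own C' ou))
      elsewhere x x≢v (no x≢u) =
        cong (λ c → if ⌊ own? x ⌋ then 0 else 1 ∸ c) (sym (other s x≢u x≢v))

    -- `d` is 1 if the arriving pebble completes a pair on `v`, and 0 otherwise; `u` lies outside
    -- the root's part and stores no tempo.
    tempi-inward : ∀ d → ¬ Own u → Own v → ⌊ suc (C v) /2⌋ ≡ d + ⌊ C v /2⌋ →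
      tempi C' ≡ d + tempi C
    tempi-inward d ¬ou ov half = size-at v d
      (trans (pairs-own C' ov) (trans (cong ⌊_/2⌋ (dst s)) (trans half
        (cong (d +_) (sym (pairs-own C ov))))))
      λ x x≢v → elsewhere x x≢v (decV a x u)
      where
      elsewhere : ∀ x → x ≢ v → Dec (x ≡ u) → pairs C' x ≡ pairs C x
      elsewhere x x≢v (yes refl) = trans (pairs-foreign C' ¬ou) (sym (pairs-foreign C ¬ou))
      elsewhere x x≢v (no x≢u) =
        cong (λ c → if ⌊ own? x ⌋ then ⌊ c /2⌋ else 0) (other s x≢u x≢v)

    vacancies-inward : ¬ Own u → Own v → C u ≡ 2 → vacancies C' ≡ 1 + vacancies C
    vacancies-inward ¬ou ov Cu = size-at u 1
      (trans (vacancy-foreign C' ¬ou) (trans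
        (cong (1 ∸_) (suc-injective (suc-injective (trans (sym (src s)) Cu))))
        (cong suc (sym (trans (vacancy-foreign C ¬ou) (cong (1 ∸_) Cu))))))
      λ x x≢u → elsewhere x x≢u (decV a x v)
      where
      elsewhere : ∀ x → x ≢ u → Dec (x ≡ v) → vacancy C' x ≡ vacancy C x
      elsewhere x x≢u (yes refl) = trans (vacancy-own C' ov) (sym (vacancy-own C ov))
      elsewhere x x≢u (no x≢v) =
        cong (λ c → if ⌊ own? x ⌋ then 0 else 1 ∸ c) (other s x≢u x≢v)

    step-parity : ∀ {y} → y ≢ v → parity (C' y) ≡ parity (C y)
    step-parity {y} y≢v with decV a y u
    ... | yes refl = sym (cong parity (src s))
    ... | no y≢u   = cong parity (other s y≢u y≢v)

    unloaded≢src : ∀ {y} → C y ≤ 1 → y ≢ u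
    unloaded≢src Cy≤1 refl = contradiction (subst (_≤ 1) (src s) Cy≤1) λ { (s≤s ()) }

  module _ {C : Config a} {u v : Vertex a} (q : Quiet C) (¬ov : ¬ Own v)
           (cm : CanMove a C u v) where
    private
      s  = pebble-step C u v cm
      ou = loaded-own q (proj₂ cm)
      C₁ = pebble a C u v

    fill-root : C₁ r ≡ 0
    fill-root = trans (other s (unloaded≢src s (≤-trans (≤-reflexive (root q)) z≤n))
                               (own≢foreign (own refl) ¬ov)) (root q)

    fill-vacant : C v ≡ 0 →
      Quiet C₁ × vacancies C ≡ 1 + vacancies C₁ × tempi C ≡ 1 + tempi C₁
    fill-vacant Cv =
      record { root = fill-root ; foreign = λ {x} ¬ox → bound ¬ox (decV a x v) } ,
      subst (λ c → vacancies C ≡ (1 ∸ c) + vacancies C₁) Cv (vacancies-outward s ou ¬ov) ,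
      tempi-outward s ou ¬ov
      where
      bound : ∀ {x} → ¬ Own x → Dec (x ≡ v) → C₁ x ≤ 1
      bound ¬ox (yes refl) = ≤-reflexive (trans (dst s) (cong suc Cv))
      bound ¬ox (no x≢v) = subst (_≤ 1)
        (sym (other s (≢-sym (own≢foreign ou ¬ox)) x≢v)) (foreign q ¬ox)

    -- The pile on `v` runs through 1, 2, 0, so one vacancy is created. Mover's move spends one
    -- tempo and the retreat returns `d`. The condition `y ≢ u` respects the ban on undoing Mover's
    -- move, and `y ≢ r` keeps the root empty.
    overfill-retreat : C v ≡ 1 → ∀ {y} → Own y → y ≢ r → y ≢ u →
      let C₂ = pebble a C₁ v y in
      CanMove a C₁ v y × Quiet C₂ × vacancies C₂ ≡ 1 + vacancies C ×
      (∀ d → ⌊ suc (C y) /2⌋ ≡ d + ⌊ C y /2⌋ → suc (tempi C₂) ≡ d + tempi C)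
    overfill-retreat Cv {y} oy y≢r y≢u =
      cm₂ ,
      record { root = trans (other s₂ (own≢foreign (own refl) ¬ov) (≢-sym y≢r)) fill-root
             ; foreign = λ {x} ¬ox → bound ¬ox (decV a x v) } ,
      trans (vacancies-inward s₂ ¬ov oy C₁v)
            (cong suc (sym (subst (λ c → vacancies C ≡ (1 ∸ c) + vacancies C₁) Cv
                                  (vacancies-outward s ou ¬ov)))) ,
      λ d half → trans
        (cong suc (tempi-inward s₂ d ¬ov oy
          (subst (λ c → ⌊ suc c /2⌋ ≡ d + ⌊ c /2⌋) (sym (other s y≢u (own≢foreign oy ¬ov))) half)))
        (trans (sym (+-suc d (tempi C₁))) (cong (d +_) (sym (tempi-outward s ou ¬ov))))
      where
      C₂ = pebble a C₁ v y
      C₁v : C₁ v ≡ 2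
      C₁v = trans (dst s) (cong suc Cv)
      cm₂ : CanMove a C₁ v y
      cm₂ = (own-to-foreign oy ¬ov ∘ sym) , ≤-reflexive (sym C₁v)
      s₂ = pebble-step C₁ v y cm₂
      bound : ∀ {x} → ¬ Own x → Dec (x ≡ v) → C₂ x ≤ 1
      bound ¬ox (yes refl) =
        subst (_≤ 1) (suc-injective (suc-injective (trans (sym C₁v) (src s₂)))) z≤n
      bound ¬ox (no x≢v) = subst (_≤ 1)
        (sym (trans (other s₂ x≢v (≢-sym (own≢foreign oy ¬ox)))
                    (other s (≢-sym (own≢foreign ou ¬ox)) x≢v)))
        (foreign q ¬ox)

  -- Counting pebbles against vacancies and tempi.

  vacancies+part≤sum : ∀ C → vacancies C + lookup a (proj₁ r) ≤ sum a
  vacancies+part≤sum C = subst₂ _≤_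
    (trans (size-+ (vacancy C) own-part) (cong (vacancies C +_) (size-part (proj₁ r))))
    size-one (size-mono λ x → bound (own? x))
    where
    bound : ∀ {x} → Dec (Own x) → vacancy C x + own-part x ≤ 1
    bound (yes ox) = ≤-reflexive (cong₂ _+_ (vacancy-own C ox) (own-part-own ox))
    bound {x} (no ¬ox) = subst (_≤ 1)
      (sym (trans (cong₂ _+_ (vacancy-foreign C ¬ox) (own-part-foreign ¬ox)) (+-identityʳ _)))
      (m∸n≤m 1 (C x))

  -- The empty configuration thus has N vacancies. This serves to find a vertex outside the root's
  -- part and to treat configurations of size zero.
  part+vacancies-empty : lookup a (proj₁ r) + vacancies (λ _ → 0) ≡ sum a
  part+vacancies-empty = begin
    lookup a (proj₁ r) + vacancies (λ _ → 0)
      ≡⟨ cong (_+ vacancies (λ _ → 0)) (size-part (proj₁ r)) ⟨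
    size a own-part + vacancies (λ _ → 0)
      ≡⟨ size-+ own-part (vacancy (λ _ → 0)) ⟨
    size a (λ x → own-part x + vacancy (λ _ → 0) x)
      ≡⟨ size-cong (λ x → pointwise (own? x)) ⟩
    size a (λ _ → 1)
      ≡⟨ size-one ⟩
    sum a ∎
    where
    open ≡-Reasoning
    pointwise : ∀ {x} → Dec (Own x) → own-part x + vacancy (λ _ → 0) x ≡ 1
    pointwise (yes ox) = cong₂ _+_ (own-part-own ox) (vacancy-own (λ _ → 0) ox)
    pointwise (no ¬ox) = cong₂ _+_ (own-part-foreign ¬ox) (vacancy-foreign (λ _ → 0) ¬ox)

  -- The correction X collects own vertices with an even number of pebbles,
  -- for which C x ≤ 1 + 2 ⌊ C x /2⌋ is not sharp.
  size-bound : ∀ {C} → Quiet C → (X : Config a) →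
    (∀ {x} → Own x → C x + X x ≤ 1 + (⌊ C x /2⌋ + ⌊ C x /2⌋)) →
    (∀ {x} → ¬ Own x → X x ≡ 0) →
    size a C + (vacancies C + size a X) ≤ sum a + (tempi C + tempi C)
  size-bound {C} q X on-own on-foreign = subst₂ _≤_
    (trans (size-+ C _) (cong (size a C +_) (size-+ (vacancy C) X)))
    (trans (size-+ (λ _ → 1) _) (cong₂ _+_ size-one (size-+ (pairs C) (pairs C))))
    (size-mono λ x → bound (own? x))
    where
    bound : ∀ {x} → Dec (Own x) → C x + (vacancy C x + X x) ≤ 1 + (pairs C x + pairs C x)
    bound {x} (yes ox) = subst₂ (λ s t → C x + (s + X x) ≤ 1 + (t + t))
      (sym (vacancy-own C ox)) (sym (pairs-own C ox)) (on-own ox)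
    bound {x} (no ¬ox) = ≤-trans
      (≤-reflexive (cong (C x +_) (trans
        (cong₂ _+_ (vacancy-foreign C ¬ox) (on-foreign ¬ox)) (+-identityʳ _))))
      (≤-trans (≤-reflexive (m+[n∸m]≡n (foreign q ¬ox))) (s≤s z≤n))

  -- The empty root is an even pile, which sharpens the estimate by one.
  size-bound-root : ∀ {C} → Quiet C →
    size a C + (vacancies C + 1) ≤ sum a + (tempi C + tempi C)
  size-bound-root {C} q = subst (λ k → size a C + (vacancies C + k) ≤ sum a + (tempi C + tempi C)) (size-point r 1)
    (size-bound q (point r 1) (λ {x} _ → bound (decV a x r))
      λ ¬ox → point-other 1 (≢-sym (own≢foreign (own refl) ¬ox)))
    where
    bound : ∀ {x} → Dec (x ≡ r) → C x + point r 1 x ≤ 1 + (⌊ C x /2⌋ + ⌊ C x /2⌋)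
    bound (yes refl) = ≤-trans
      (≤-reflexive (cong₂ _+_ (root q) (point-self r 1))) (s≤s z≤n)
    bound {x} (no x≢r) = ≤-trans
      (≤-reflexive (trans (cong (C x +_) (point-other 1 x≢r)) (+-identityʳ _)))
      (n≤1+2⌊n/2⌋ (C x))

  -- A second even pile in the root's part sharpens the estimate by one more, which is what yields M
  -- ≥ e + 3 when not all piles are odd.
  size-bound-even : ∀ {C z} → Quiet C → Own z → z ≢ r → parity (C z) ≡ 0ℙ →
    size a C + (vacancies C + 2) ≤ sum a + (tempi C + tempi C)
  size-bound-even {C} {z} q oz z≢r even = subst (λ k → size a C + (vacancies C + k) ≤ sum a + (tempi C + tempi C))
    (trans (size-+ (point r 1) (point z 1)) (cong₂ _+_ (size-point r 1) (size-point z 1)))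
    (size-bound q (λ x → point r 1 x + point z 1 x) (λ {x} _ → bound (decV a x r) (decV a x z))
      λ ¬ox → cong₂ _+_ (point-other 1 (≢-sym (own≢foreign (own refl) ¬ox)))
                        (point-other 1 (≢-sym (own≢foreign oz ¬ox))))
    where
    bound : ∀ {x} → Dec (x ≡ r) → Dec (x ≡ z) →
      C x + (point r 1 x + point z 1 x) ≤ 1 + (⌊ C x /2⌋ + ⌊ C x /2⌋)
    bound (yes refl) _ = ≤-trans
      (≤-reflexive (cong₂ _+_ (root q) (cong₂ _+_ (point-self r 1) (point-other 1 (≢-sym z≢r)))))
      (s≤s z≤n)
    bound (no x≢r) (yes refl) = ≤-trans
      (≤-reflexive (trans (cong (C z +_) (cong₂ _+_ (point-other 1 x≢r) (point-self z 1)))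
                          (+-comm (C z) 1)))
      (s≤s (even⇒n≤2⌊n/2⌋ (C z) even))
    bound {x} (no x≢r) (no x≢z) = ≤-trans
      (≤-reflexive (trans (cong (C x +_) (cong₂ _+_ (point-other 1 x≢r) (point-other 1 x≢z)))
                          (+-identityʳ _)))
      (n≤1+2⌊n/2⌋ (C x))

  -- Mover's strategy.

  module Mover (v : Vertex a) (¬ov : ¬ Own v) where

    -- Mover fills a vacant vertex. An answer onto an occupied vertex gives it two pebbles and loses
    -- at once, so Defender must fill too, and both counts fall by two. Both moves end outside the
    -- root's part, so the parities inside it survive.
    fill-both : ∀ {C} → Quiet C → 1 ≤ vacancies C → 2 ≤ tempi C →
      (∀ C₂ → vacancies C ≡ 2 + vacancies C₂ → tempi C ≡ 2 + tempi C₂ →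
        (∀ {y} → Own y → parity (C₂ y) ≡ parity (C y)) → MoverTurn a r C₂) →
      MoverTurn a r C
    fill-both {C} q 1≤e 2≤M continue
      with w , ¬ow , Cw ← find-vacant {C} 1≤e
      with x , ox , 2≤Cx ← find-loaded {C} (≤-trans (n≤1+n 1) 2≤M)
      = moveM x w cm (allD (x' , w , own-to-foreign ox' ¬ow , 2≤C₁x') respond)
      where
      cm : CanMove a C x w
      cm = own-to-foreign ox ¬ow , 2≤Cx
      C₁ = pebble a C x w
      s₁ = pebble-step C x w cm
      filled = fill-vacant q ¬ow cm Cw
      q₁ = proj₁ filled
      e≡ = proj₁ (proj₂ filled)
      M≡ = proj₂ (proj₂ filled)
      loaded = find-loaded {C₁} (s≤s⁻¹ (subst (2 ≤_) M≡ 2≤M))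
      x' = proj₁ loaded
      ox' = proj₁ (proj₂ loaded)
      2≤C₁x' = proj₂ (proj₂ loaded)
      respond : ∀ s t → CanMove a C₁ s t → ¬ (s ≡ w × t ≡ x) → MoverTurn a r (pebble a C₁ s t)
      respond s t cm₂ _ = answer (≤1-cases (foreign q₁ ¬ot))
        where
        os : Own s
        os = loaded-own q₁ (proj₂ cm₂)
        ¬ot : ¬ Own t
        ¬ot ot = proj₁ cm₂ (trans (same-part os) (sym (same-part ot)))
        s₂ = pebble-step C₁ s t cm₂
        answer : C₁ t ≡ 0 ⊎ C₁ t ≡ 1 → MoverTurn a r (pebble a C₁ s t)
        answer (inj₂ C₁t) =
          overfull-wins ¬ot (≤-reflexive (sym (trans (dst s₂) (cong suc C₁t))))
        answer (inj₁ C₁t) with _ , e₂≡ , M₂≡ ← fill-vacant q₁ ¬ot cm₂ C₁t =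
          continue _ (trans e≡ (cong suc e₂≡)) (trans M≡ (cong suc M₂≡))
            λ oy → trans (step-parity s₂ (own≢foreign oy ¬ot)) (step-parity s₁ (own≢foreign oy ¬ow))

    -- Paired filling leads down to one vacancy and at least two tempi. Mover fills that vacancy,
    -- and Defender, forced to spend a tempo, can only overfill.
    odd-vacancies-win : ∀ h C → vacancies C ≡ suc (h + h) → 2 + (h + h) ≤ tempi C →
      MoverTurn a r C
    odd-vacancies-win h C e≡ M≥ with wins-or-quiet C
    ... | inj₁ win = win
    ... | inj₂ q = fill-both q (subst (1 ≤_) (sym e≡) (s≤s z≤n))
                     (≤-trans (s≤s (s≤s z≤n)) M≥) (next h e≡ M≥)
      where
      next : ∀ h → vacancies C ≡ suc (h + h) → 2 + (h + h) ≤ tempi C → ∀ C₂ →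
        vacancies C ≡ 2 + vacancies C₂ → tempi C ≡ 2 + tempi C₂ →
        (∀ {y} → Own y → parity (C₂ y) ≡ parity (C y)) → MoverTurn a r C₂
      -- With a single vacancy Defender cannot have filled a second one.
      next zero e≡ _ C₂ e₂≡ _ _ with () ← trans (sym e≡) e₂≡
      next (suc h) e≡ M≥ C₂ e₂≡ M₂≡ _ = odd-vacancies-win h C₂
        (suc-injective (suc-injective (trans (sym e₂≡) (trans e≡ (cong (2 +_) (+-suc h h))))))
        (s≤s⁻¹ (s≤s⁻¹ (subst₂ _≤_ (cong (3 +_) (+-suc h h)) M₂≡ M≥)))

    AllOdd : Config a → Set
    AllOdd C = ∀ {y} → Own y → y ≢ r → parity (C y) ≡ 1ℙ

    -- Mover overfills `v` and threatens the root. Apart from answers that lose at once, Defender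
    -- must carry the pebbles of `v` to another vertex of the root's part, which leaves one vacancy,
    -- and Mover then needs two tempi. They remain if one was to spare, or if the retreat meets an
    -- odd pile and restores one.
    no-vacancies-win : ∀ {C} → Quiet C → vacancies C ≡ 0 → 2 ≤ tempi C →
      3 ≤ tempi C ⊎ AllOdd C → MoverTurn a r C
    no-vacancies-win {C} q e≡0 2≤M spare
      with x , ox , 2≤Cx ← find-loaded {C} (≤-trans (n≤1+n 1) 2≤M)
      = moveM x v cm (allD (v , r , (¬ov ∘ own) , 2≤C₁v) respond)
      where
      cm : CanMove a C x v
      cm = own-to-foreign ox ¬ov , 2≤Cx
      C₁ = pebble a C x v
      s₁ = pebble-step C x v cm
      Cv : C v ≡ 1
      Cv = no-vacancies⇒filled q e≡0 ¬ov
      2≤C₁v : 2 ≤ C₁ v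
      2≤C₁v = ≤-reflexive (sym (trans (dst s₁) (cong suc Cv)))
      respond : ∀ s t → CanMove a C₁ s t → ¬ (s ≡ v × t ≡ x) → MoverTurn a r (pebble a C₁ s t)
      respond s t cm₂ not-back = answer (decV a s v) (decV a t v) (decV a t r) (own? t)
        where
        C₂ = pebble a C₁ s t
        s₂ = pebble-step C₁ s t cm₂
        answer : Dec (s ≡ v) → Dec (t ≡ v) → Dec (t ≡ r) → Dec (Own t) → MoverTurn a r C₂
        answer _ (yes refl) _ _ =
          overfull-wins ¬ov (≤-trans 2≤C₁v (≤-trans (n≤1+n _) (≤-reflexive (sym (dst s₂)))))
        answer (no s≢v) (no t≢v) _ _ =
          overfull-wins ¬ov (subst (2 ≤_) (sym (other s₂ (≢-sym s≢v) (≢-sym t≢v))) 2≤C₁v)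
        answer (yes refl) (no t≢v) (yes refl) _ = rootM (subst (1 ≤_) (sym (dst s₂)) (s≤s z≤n))
        -- No vertex outside the root's part is empty, so this answer overfills `t`.
        answer (yes refl) (no t≢v) (no t≢r) (no ¬ot) =
          overfull-wins ¬ot (≤-reflexive (sym (trans (dst s₂) (cong suc (trans
            (other s₁ (≢-sym (own≢foreign ox ¬ot)) t≢v) (no-vacancies⇒filled q e≡0 ¬ot))))))
        answer (yes refl) (no t≢v) (no t≢r) (yes ot)
          with _ , _ , e₂≡ , M₂≡ ← overfill-retreat q ¬ov cm Cv ot t≢r (λ t≡x → not-back (refl , t≡x))
          = odd-vacancies-win 0 C₂ (trans e₂≡ (cong suc e≡0)) (enough (⌊1+n/2⌋-cases (C t)) spare)
          where
          enough : (parity (C t) ≡ 0ℙ × ⌊ suc (C t) /2⌋ ≡ ⌊ C t /2⌋)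
                 ⊎ (parity (C t) ≡ 1ℙ × ⌊ suc (C t) /2⌋ ≡ 1 + ⌊ C t /2⌋) →
            3 ≤ tempi C ⊎ AllOdd C → 2 ≤ tempi C₂
          enough (inj₂ (_ , half)) _ = s≤s⁻¹ (subst (3 ≤_) (sym (M₂≡ 1 half)) (s≤s 2≤M))
          enough (inj₁ (_ , half)) (inj₁ 3≤M) = s≤s⁻¹ (subst (3 ≤_) (sym (M₂≡ 0 half)) 3≤M)
          enough (inj₁ (even , _)) (inj₂ odd) with () ← trans (sym even) (odd ot t≢r)

    -- Paired filling reduces this to the case of no vacancies. It preserves M - e and the parities
    -- in the root's part, so either kind of reserve persists.
    even-vacancies-win : ∀ h C → vacancies C ≡ h + h → 2 + (h + h) ≤ tempi C →
      3 + (h + h) ≤ tempi C ⊎ AllOdd C → MoverTurn a r C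
    even-vacancies-win h C e≡ M≥ spare with wins-or-quiet C
    ... | inj₁ win = win
    even-vacancies-win zero C e≡ M≥ spare | inj₂ q = no-vacancies-win q e≡ M≥ spare
    even-vacancies-win (suc h) C e≡ M≥ spare | inj₂ q =
      fill-both q (subst (1 ≤_) (sym e≡) (s≤s z≤n)) (≤-trans (s≤s (s≤s z≤n)) M≥)
        λ C₂ e₂≡ M₂≡ same → even-vacancies-win h C₂
          (suc-injective (suc-injective (trans (sym e₂≡) (trans e≡ (cong suc (+-suc h h))))))
          (s≤s⁻¹ (s≤s⁻¹ (subst₂ _≤_ (cong (3 +_) (+-suc h h)) M₂≡ M≥)))
          (spare₂ M₂≡ same spare)
      where
      spare₂ : ∀ {C₂} → tempi C ≡ 2 + tempi C₂ → (∀ {y} → Own y → parity (C₂ y) ≡ parity (C y)) →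
        3 + (suc h + suc h) ≤ tempi C ⊎ AllOdd C → 3 + (h + h) ≤ tempi C₂ ⊎ AllOdd C₂
      spare₂ M₂≡ _ (inj₁ M≥) = inj₁ (s≤s⁻¹ (s≤s⁻¹ (subst₂ _≤_ (cong (4 +_) (+-suc h h)) M₂≡ M≥)))
      spare₂ _ same (inj₂ odd) = inj₂ λ oy y≢r → trans (same oy) (odd oy y≢r)

    -- Counting gives N + K + e + c ≤ 2M, where c is the number of piles in the root's part known to
    -- be even: 1 for the root alone, 2 with a further one. Halving then yields the tempi that the
    -- strategies demand.
    large-configurations-win : ∀ N K → sum a ≡ lookup a (proj₁ r) + N →
      2 ≤ K → (∀ h → N ≡ h + h → 3 ≤ K) →
      ∀ C → sum a + N + K ≤ size a C → MoverTurn a r C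
    large-configurations-win N K sum≡ 2≤K even⇒3≤K C large with wins-or-quiet C
    ... | inj₁ win = win
    ... | inj₂ q = by-parity (even-or-odd e)
      where
      e = vacancies C
      M = tempi C
      e≤N : e ≤ N
      e≤N = +-cancelʳ-≤ (lookup a (proj₁ r)) e N
        (≤-trans (vacancies+part≤sum C) (≤-reflexive (trans sum≡ (+-comm _ N))))
      surplus : ∀ c → size a C + (e + c) ≤ sum a + (M + M) → N + K + (e + c) ≤ M + M
      surplus c p = +-cancelˡ-≤ (sum a) _ _ (≤-trans
        (≤-reflexive (assoc (sum a) N K (e + c))) (≤-trans (+-monoˡ-≤ (e + c) large) p))
        where
        assoc : ∀ s n k t → s + (n + k + t) ≡ s + n + k + t
        assoc = solve-∀
      by-parity : (∃[ h ] e ≡ h + h) ⊎ (∃[ h ] e ≡ suc (h + h)) → MoverTurn a r C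
      by-parity (inj₂ (h , e≡)) = odd-vacancies-win h C e≡ (subst (λ k → suc k ≤ M) e≡
        (double-cancel-< (≤-trans (subst (_≤ N + K + (e + 1)) (+-suc e e)
          (+-mono-≤ (≤-trans e≤N (m≤m+n N K)) (≤-reflexive (+-comm 1 e))))
          (surplus 1 (size-bound-root q)))))
      by-parity (inj₁ (h , e≡)) = even-vacancies-win h C e≡
        (subst (λ k → 2 + k ≤ M) e≡ (double-cancel-< (≤-trans (≤-trans (m≤m+n _ 1) (more 1)) (surplus 1 (size-bound-root q)))))
        spare
        where
        -- If e = N then N is even and K ≥ 3; if e < N then K ≥ 2 suffices.
        e+3≤N+K : e + 3 ≤ N + K
        e+3≤N+K with m≤n⇒m<n∨m≡n e≤N
        ... | inj₁ e<N = ≤-trans (≤-reflexive (+-suc e 2)) (+-mono-≤ e<N 2≤K)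
        ... | inj₂ e≡N = +-mono-≤ e≤N (even⇒3≤K h (trans (sym e≡N) e≡))
        more : ∀ c → suc (suc e + suc e) + c ≤ N + K + (e + c)
        more c = ≤-trans (≤-reflexive (regroup e c)) (+-monoˡ-≤ (e + c) e+3≤N+K)
          where
          regroup : ∀ e c → suc (suc e + suc e) + c ≡ e + 3 + (e + c)
          regroup = solve-∀
        -- An even pile besides the root allows c = 2, hence 2M ≥ 2e + 5 and M ≥ e + 3; without one
        -- `AllOdd` holds.
        spare : 3 + (h + h) ≤ M ⊎ AllOdd C
        spare with any-vertex? (λ z → own? z ×-dec ¬? (decV a z r) ×-dec (parity (C z) ≟ᴾ 0ℙ))
        ... | yes (z , oz , z≢r , even) = inj₁ (subst (λ k → 3 + k ≤ M) e≡ (double-cancel-<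
          (≤-trans (≤-trans (≤-reflexive (regroup e)) (more 2)) (surplus 2 (size-bound-even q oz z≢r even)))))
          where
          regroup : ∀ e → suc (suc (suc e) + suc (suc e)) ≡ suc (suc e + suc e) + 2
          regroup = solve-∀
        ... | no none = inj₂ λ {y} oy y≢r → odd (parity (C y)) λ even → none (y , oy , y≢r , even)
          where
          odd : ∀ p → p ≢ 0ℙ → p ≡ 1ℙ
          odd 0ℙ p≢ = contradiction refl p≢
          odd 1ℙ _  = refl

  -- Defender's strategy.

  data Balance (C : Config a) : Set where
    even  : ∀ h → vacancies C ≡ h + h → tempi C ≤ suc (h + h) → Balance C
    odd   : ∀ h → vacancies C ≡ suc (h + h) → tempi C ≤ suc (h + h) → Balance C
    slack : ∀ h {z} → Own z → z ≢ r → C z ≡ 0 →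
            vacancies C ≡ h + h → tempi C ≤ 2 + (h + h) → Balance C

  module Defender (mate : ∀ {u} → Own u → ∃[ y ] (Own y × y ≢ r × y ≢ u)) where

    -- Only e = 1 could leave Defender without a vacancy, but there balance allows a single tempo,
    -- against the two assumed.
    fillable : ∀ {C e₁} → Balance C → vacancies C ≡ 1 + e₁ → 2 ≤ tempi C → 1 ≤ e₁
    fillable {e₁ = suc _} _ _ _ = s≤s z≤n
    fillable {e₁ = zero} (even zero e≡ _) e₁≡ _ with () ← trans (sym e≡) e₁≡
    fillable {e₁ = zero} (even (suc h) e≡ _) e₁≡ _
      with () ← trans (sym (+-suc h h)) (suc-injective (trans (sym e≡) e₁≡))
    fillable {e₁ = zero} (slack zero _ _ _ e≡ _) e₁≡ _ with () ← trans (sym e≡) e₁≡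
    fillable {e₁ = zero} (slack (suc h) _ _ _ e≡ _) e₁≡ _
      with () ← trans (sym (+-suc h h)) (suc-injective (trans (sym e≡) e₁≡))
    fillable {e₁ = zero} (odd zero _ M≤) _ 2≤M = contradiction M≤ (<⇒≱ 2≤M)
    fillable {e₁ = zero} (odd (suc h) e≡ _) e₁≡ _
      with () ← suc-injective (trans (sym e≡) e₁≡)

    -- Tempi and vacancies both fall by two, so each inequality is kept; the last premise preserves
    -- the empty vertex of `slack`.
    balance-fill : ∀ {C C₂} → Balance C → vacancies C ≡ 2 + vacancies C₂ →
      tempi C ≡ 2 + tempi C₂ → (∀ {z} → Own z → C z ≡ 0 → C₂ z ≡ 0) → Balance C₂
    balance-fill (even (suc h) e≡ M≤) e₂≡ M₂≡ _ = even h
      (suc-injective (suc-injective (trans (sym e₂≡) (trans e≡ (cong suc (+-suc h h))))))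
      (s≤s⁻¹ (s≤s⁻¹ (subst₂ _≤_ M₂≡ (cong (2 +_) (+-suc h h)) M≤)))
    balance-fill (odd (suc h) e≡ M≤) e₂≡ M₂≡ _ = odd h
      (suc-injective (suc-injective (trans (sym e₂≡) (trans e≡ (cong (2 +_) (+-suc h h))))))
      (s≤s⁻¹ (s≤s⁻¹ (subst₂ _≤_ M₂≡ (cong (2 +_) (+-suc h h)) M≤)))
    balance-fill (slack (suc h) oz z≢r Cz e≡ M≤) e₂≡ M₂≡ keep = slack h oz z≢r (keep oz Cz)
      (suc-injective (suc-injective (trans (sym e₂≡) (trans e≡ (cong suc (+-suc h h))))))
      (s≤s⁻¹ (s≤s⁻¹ (subst₂ _≤_ M₂≡ (cong (3 +_) (+-suc h h)) M≤)))
    balance-fill (even zero e≡ _) e₂≡ _ _ with () ← trans (sym e≡) e₂≡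
    balance-fill (odd zero e≡ _) e₂≡ _ _ with () ← trans (sym e≡) e₂≡
    balance-fill (slack zero _ _ _ e≡ _) e₂≡ _ _ with () ← trans (sym e≡) e₂≡

    -- A retreat adds a vacancy, which switches the parity, while over the whole round the tempi do
    -- not grow. From `slack` the retreat goes to the empty vertex itself: a tempo is lost for good
    -- and `odd` results. That vertex is not `u`, which holds two pebbles.
    balance-retreat : ∀ {C u} → Own u → 2 ≤ C u → Balance C →
      ∃[ y ] (Own y × y ≢ r × y ≢ u ×
        (∀ C₂ → vacancies C₂ ≡ 1 + vacancies C →
          (∀ d → ⌊ suc (C y) /2⌋ ≡ d + ⌊ C y /2⌋ → suc (tempi C₂) ≡ d + tempi C) → Balance C₂))
    balance-retreat {C} ou 2≤Cu b = respond b
      where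
      no-gain : ∀ C₂ c → (∀ d → ⌊ suc c /2⌋ ≡ d + ⌊ c /2⌋ → suc (tempi C₂) ≡ d + tempi C) →
        tempi C₂ ≤ tempi C
      no-gain C₂ c M₂≡ with ⌊1+n/2⌋-cases c
      ... | inj₁ (_ , half) = ≤-trans (n≤1+n _) (≤-reflexive (M₂≡ 0 half))
      ... | inj₂ (_ , half) = ≤-reflexive (suc-injective (M₂≡ 1 half))
      respond : Balance C → _
      respond (even h e≡ M≤) with y , oy , y≢r , y≢u ← mate ou =
        y , oy , y≢r , y≢u , λ C₂ e₂≡ M₂≡ →
          odd h (trans e₂≡ (cong suc e≡)) (≤-trans (no-gain C₂ (C y) M₂≡) M≤)
      respond (odd h e≡ M≤) with y , oy , y≢r , y≢u ← mate ou =
        y , oy , y≢r , y≢u , λ C₂ e₂≡ M₂≡ →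
          even (suc h) (trans e₂≡ (cong suc (trans e≡ (sym (+-suc h h)))))
            (≤-trans (no-gain C₂ (C y) M₂≡)
              (≤-trans M≤ (s≤s (+-mono-≤ (n≤1+n h) (n≤1+n h)))))
      respond (slack h {z} oz z≢r Cz e≡ M≤) =
        z , oz , z≢r , (λ { refl → contradiction (≤-trans 2≤Cu (≤-reflexive Cz)) λ () }) ,
        λ C₂ e₂≡ M₂≡ → odd h (trans e₂≡ (cong suc e≡)) (s≤s⁻¹ (≤-trans
          (≤-reflexive (M₂≡ 0 (subst (λ c → ⌊ suc c /2⌋ ≡ ⌊ c /2⌋) (sym Cz) refl))) M≤))

    -- `Balance` is Defender's invariant: a filling is answered by a filling, an overfilling by a
    -- retreat, and either restores it. The recursion runs on Mover's alleged winning strategy.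
    balanced-loses : ∀ {C} → Quiet C → Balance C → ¬ MoverTurn a r C
    balanced-loses q b (rootM p) with () ← subst (1 ≤_) (root q) p
    balanced-loses {C} q b (moveM u v cm after) = answer after (≤1-cases (foreign q ¬ov))
      where
      ou : Own u
      ou = loaded-own q (proj₂ cm)
      ¬ov : ¬ Own v
      ¬ov ov = proj₁ cm (trans (same-part ou) (sym (same-part ov)))
      C₁ = pebble a C u v
      s₁ = pebble-step C u v cm
      answer : AfterMover a r u v C₁ → C v ≡ 0 ⊎ C v ≡ 1 → ⊥
      answer (rootD p) _ with () ← subst (1 ≤_) (fill-root q ¬ov cm) p
      -- The move guaranteed by `allD` supplies a loaded `x`; Defender plays from it to a vacant `w`
      -- instead. This does not undo Mover's move, as `x` lies in the root's part and `v` does not.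
      answer (allD (x , y , x~y , 2≤C₁x) respond) (inj₁ Cv)
        with q₁ , e≡ , M≡ ← fill-vacant q ¬ov cm Cv
        with ox ← loaded-own q₁ 2≤C₁x
        with w , ¬ow , C₁w ← find-vacant {C₁} (fillable b e≡
          (subst (2 ≤_) (sym M≡) (s≤s (loaded⇒1≤tempi {C₁} ox 2≤C₁x))))
        with cm₂ ← (own-to-foreign ox ¬ow , 2≤C₁x)
        with q₂ , e₂≡ , M₂≡ ← fill-vacant q₁ ¬ow cm₂ C₁w
        = balanced-loses q₂
            (balance-fill b (trans e≡ (cong suc e₂≡)) (trans M≡ (cong suc M₂≡)) keep)
            (respond x w cm₂ λ (x≡v , _) → own≢foreign ox ¬ov x≡v)
        where
        keep : ∀ {z} → Own z → C z ≡ 0 → pebble a C₁ x w z ≡ 0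
        keep {z} oz Cz = trans (other (pebble-step C₁ x w cm₂)
          (unloaded≢src (pebble-step C₁ x w cm₂) (≤-trans (≤-reflexive C₁z) z≤n))
          (own≢foreign oz ¬ow)) C₁z
          where
          C₁z : C₁ z ≡ 0
          C₁z = trans (other s₁ (unloaded≢src s₁ (≤-trans (≤-reflexive Cz) z≤n))
            (own≢foreign oz ¬ov)) Cz
      answer (allD _ respond) (inj₂ Cv)
        with y , oy , y≢r , y≢u , balance ← balance-retreat ou (proj₂ cm) b
        with cm₂ , q₂ , e₂≡ , M₂≡ ← overfill-retreat q ¬ov cm Cv oy y≢r y≢u
        = balanced-loses q₂ (balance _ e₂≡ M₂≡) (respond v y cm₂ λ (_ , y≡u) → y≢u y≡u)

    -- Losing configurations of every size below the threshold.

    module Deployment (h : ℕ) (F : Config a)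
      (F-own : ∀ {x} → Own x → F x ≡ 0) (F≤1 : ∀ x → F x ≤ 1)
      (F-size : size a F + (h + h) + lookup a (proj₁ r) ≡ sum a) where

      private
        -- The most tempi that `slack` tolerates with 2h vacancies.
        g = 2 + (h + h)
        own-r : Own r
        own-r = own refl
        spare = mate own-r
        z = proj₁ spare
        oz = proj₁ (proj₂ spare)
        z≢r = proj₁ (proj₂ (proj₂ spare))
        stock = mate oz
        y = proj₁ stock
        oy = proj₁ (proj₂ stock)
        y≢r = proj₁ (proj₂ (proj₂ stock))
        y≢z = proj₂ (proj₂ (proj₂ stock))

      -- The largest stock in the root's part, of size p, that has `g` tempi and leaves `r` and `z`
      -- empty: single pebbles on the other vertices and 2g more on `y`, in all p - 2 + 2g.
      garrison : Config a
      garrison x = if ⌊ decV a x r ⌋ then 0 else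
                   if ⌊ decV a x z ⌋ then 0 else own-part x + point y (g + g) x

      garrison-root : garrison r ≡ 0
      garrison-root = if-yes (decV a r r) refl

      garrison-spare : garrison z ≡ 0
      garrison-spare = trans (if-no (decV a z r) z≢r) (if-yes (decV a z z) refl)

      garrison-other : ∀ {x} → x ≢ r → x ≢ z → garrison x ≡ own-part x + point y (g + g) x
      garrison-other x≢r x≢z = trans (if-no (decV a _ r) x≢r) (if-no (decV a _ z) x≢z)

      garrison-foreign : ∀ {x} → ¬ Own x → garrison x ≡ 0
      garrison-foreign ¬ox = trans
        (garrison-other (≢-sym (own≢foreign own-r ¬ox)) (≢-sym (own≢foreign oz ¬ox)))
        (cong₂ _+_ (own-part-foreign ¬ox) (point-other (g + g) (≢-sym (own≢foreign oy ¬ox))))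

      garrison-size : size a garrison + 2 ≡ lookup a (proj₁ r) + (g + g)
      garrison-size = begin
        size a garrison + 2
          ≡⟨ cong (size a garrison +_) (cong₂ _+_ (size-point r 1) (size-point z 1)) ⟨
        size a garrison + (size a (point r 1) + size a (point z 1))
          ≡⟨ cong (size a garrison +_) (size-+ (point r 1) (point z 1)) ⟨
        size a garrison + size a (λ x → point r 1 x + point z 1 x)
          ≡⟨ size-+ garrison _ ⟨
        size a (λ x → garrison x + (point r 1 x + point z 1 x))
          ≡⟨ size-cong (λ x → pointwise x (decV a x r) (decV a x z)) ⟩
        size a (λ x → own-part x + point y (g + g) x)
          ≡⟨ size-+ own-part (point y (g + g)) ⟩
        size a own-part + size a (point y (g + g))
          ≡⟨ cong₂ _+_ (size-part (proj₁ r)) (size-point y (g + g)) ⟩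
        lookup a (proj₁ r) + (g + g) ∎
        where
        open ≡-Reasoning
        pointwise : ∀ x → Dec (x ≡ r) → Dec (x ≡ z) →
          garrison x + (point r 1 x + point z 1 x) ≡ own-part x + point y (g + g) x
        pointwise x (yes refl) _ = trans
          (cong₂ _+_ garrison-root (cong₂ _+_ (point-self r 1) (point-other 1 (≢-sym z≢r))))
          (sym (cong₂ _+_ (own-part-own own-r) (point-other (g + g) (≢-sym y≢r))))
        pointwise x (no x≢r) (yes refl) = trans
          (cong₂ _+_ garrison-spare (cong₂ _+_ (point-other 1 x≢r) (point-self z 1)))
          (sym (cong₂ _+_ (own-part-own oz) (point-other (g + g) (≢-sym y≢z))))
        pointwise x (no x≢r) (no x≢z) = trans
          (cong (garrison x +_) (cong₂ _+_ (point-other 1 x≢r) (point-other 1 x≢z)))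
          (trans (+-identityʳ _) (garrison-other x≢r x≢z))

      garrison-halves : ∀ {x} → Own x → ⌊ garrison x /2⌋ ≤ point y g x
      garrison-halves {x} ox = bound (decV a x r) (decV a x z) (decV a x y)
        where
        bound : Dec (x ≡ r) → Dec (x ≡ z) → Dec (x ≡ y) → ⌊ garrison x /2⌋ ≤ point y g x
        bound (yes refl) _ _ = subst (λ c → ⌊ c /2⌋ ≤ point y g r) (sym garrison-root) z≤n
        bound (no _) (yes refl) _ = subst (λ c → ⌊ c /2⌋ ≤ point y g z) (sym garrison-spare) z≤n
        bound (no x≢r) (no x≢z) (yes refl) = ≤-reflexive (trans
          (cong ⌊_/2⌋ (trans (garrison-other x≢r x≢z)
            (cong₂ _+_ (own-part-own ox) (point-self y (g + g)))))
          (trans (⌊1+2n/2⌋ g) (sym (point-self y g))))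
          where
          ⌊1+2n/2⌋ : ∀ n → ⌊ suc (n + n) /2⌋ ≡ n
          ⌊1+2n/2⌋ zero    = refl
          ⌊1+2n/2⌋ (suc n) = cong suc (trans (cong ⌊_/2⌋ (+-suc n n)) (⌊1+2n/2⌋ n))
        bound (no x≢r) (no x≢z) (no x≢y) = subst (λ c → ⌊ c /2⌋ ≤ point y g x)
          (sym (trans (garrison-other x≢r x≢z)
            (cong₂ _+_ (own-part-own ox) (point-other (g + g) x≢y)))) z≤n

      -- `F` leaves exactly 2h vacancies. Thinning the garrison adds no pairs and keeps `z` empty,
      -- so `slack` holds at every size. The bound on `s` is p - 2 + 2(2 + 2h).
      deploy : ∀ s → s ≤ lookup a (proj₁ r) + (h + h + (h + h)) + 2 →
        ∃[ C ] (size a C ≡ size a F + s × ¬ MoverTurn a r C)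
      deploy s s≤ =
        C , trans (size-+ F D) (cong (size a F +_) (proj₂ (proj₂ shrunk))) ,
        balanced-loses quiet (slack h oz z≢r
          (cong₂ _+_ (F-own oz) (n≤0⇒n≡0 (subst (D z ≤_) garrison-spare (D≤ z))))
          vacancies≡ tempi≤)
        where
        regroup : ∀ l h → l + (h + h + (h + h)) + 2 + 2 ≡ l + (2 + (h + h) + (2 + (h + h)))
        regroup = solve-∀
        shrunk = size-shrink garrison s (+-cancelʳ-≤ 2 s (size a garrison)
          (≤-trans (+-monoˡ-≤ 2 s≤)
            (≤-reflexive (trans (regroup (lookup a (proj₁ r)) h) (sym garrison-size)))))
        D = proj₁ shrunk
        D≤ = proj₁ (proj₂ shrunk)
        C : Config a
        C x = F x + D x
        C-foreign : ∀ {x} → ¬ Own x → C x ≡ F x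
        C-foreign {x} ¬ox = trans
          (cong (F x +_) (n≤0⇒n≡0 (subst (D x ≤_) (garrison-foreign ¬ox) (D≤ x))))
          (+-identityʳ (F x))
        quiet : Quiet C
        quiet = record
          { root = cong₂ _+_ (F-own own-r) (n≤0⇒n≡0 (subst (D r ≤_) garrison-root (D≤ r)))
          ; foreign = λ {x} ¬ox → subst (_≤ 1) (sym (C-foreign ¬ox)) (F≤1 x) }
        tempi≤ : tempi C ≤ g
        tempi≤ = subst (tempi C ≤_) (size-point y g) (size-mono λ x → bound (own? x))
          where
          bound : ∀ {x} → Dec (Own x) → pairs C x ≤ point y g x
          bound {x} (yes ox) = ≤-trans
            (≤-reflexive (trans (pairs-own C ox) (cong (λ c → ⌊ c + D x /2⌋) (F-own ox))))
            (≤-trans (⌊n/2⌋-mono (D≤ x)) (garrison-halves ox))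
          bound {x} (no ¬ox) = subst (_≤ point y g x) (sym (pairs-foreign C ¬ox)) z≤n
        -- Every vertex is counted once: it is pebbled by `F`, vacant, or in the root's part.
        vacancies≡ : vacancies C ≡ h + h
        vacancies≡ = +-cancelˡ-≡ (size a F) _ _ (+-cancelʳ-≡ (lookup a (proj₁ r)) _ _ (begin
          size a F + vacancies C + lookup a (proj₁ r)
            ≡⟨ cong₂ _+_ (size-+ F (vacancy C)) (size-part (proj₁ r)) ⟨
          size a (λ x → F x + vacancy C x) + size a own-part
            ≡⟨ size-+ (λ x → F x + vacancy C x) own-part ⟨
          size a (λ x → F x + vacancy C x + own-part x)
            ≡⟨ size-cong (λ x → total (own? x)) ⟩
          size a (λ _ → 1)
            ≡⟨ size-one ⟩
          sum a
            ≡⟨ F-size ⟨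
          size a F + (h + h) + lookup a (proj₁ r) ∎))
          where
          open ≡-Reasoning
          total : ∀ {x} → Dec (Own x) → F x + vacancy C x + own-part x ≡ 1
          total (yes ox) = cong₂ _+_ (cong₂ _+_ (F-own ox) (vacancy-own C ox)) (own-part-own ox)
          total {x} (no ¬ox) = trans
            (cong₂ _+_ (cong (F x +_) (trans (vacancy-foreign C ¬ox)
                         (cong (1 ∸_) (C-foreign ¬ox)))) (own-part-foreign ¬ox))
            (trans (+-identityʳ _) (m+[n∸m]≡n (F≤1 x)))

    small-configurations-even : ∀ h → sum a ≡ lookup a (proj₁ r) + (h + h) →
      ∀ s → s < sum a + (h + h) + 3 → ∃[ C ] (size a C ≡ s × ¬ MoverTurn a r C)
    small-configurations-even h sum≡ s s< =
      let s≤ = s≤s⁻¹ (≤-trans s< (≤-reflexive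
                 (trans (cong (λ n → n + (h + h) + 3) sum≡) (regroup (lookup a (proj₁ r)) h))))
          C , size≡ , loses = deploy s s≤
      in C , trans size≡ (cong (_+ s) size-zero) , loses
      where
      regroup : ∀ l h → l + (h + h) + (h + h) + 3 ≡ suc (l + (h + h + (h + h)) + 2)
      regroup = solve-∀
      open Deployment h (λ _ → 0) (λ _ → refl) (λ _ → z≤n)
        (trans (cong (λ c → c + (h + h) + lookup a (proj₁ r)) size-zero)
               (trans (+-comm (h + h) _) (sym sum≡)))

    -- One pebble outside the root's part makes the number of vacancies even, N - 1, so that `slack`
    -- applies. Size zero has no such pebble and is settled by the empty configuration.
    small-configurations-odd : ∀ h → sum a ≡ lookup a (proj₁ r) + suc (h + h) → ∀ {w} → ¬ Own w →
      ∀ s → s < sum a + suc (h + h) + 2 → ∃[ C ] (size a C ≡ s × ¬ MoverTurn a r C)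
    small-configurations-odd h sum≡ ¬ow zero _ =
      (λ _ → 0) , size-zero ,
      balanced-loses (record { root = refl ; foreign = λ _ → z≤n })
        (odd h vacancies≡ (subst (_≤ suc (h + h)) (sym tempi≡) z≤n))
      where
      tempi≡ : tempi (λ _ → 0) ≡ 0
      tempi≡ = trans (size-cong λ x → pointwise (own? x)) size-zero
        where
        pointwise : ∀ {x} → Dec (Own x) → pairs (λ _ → 0) x ≡ 0
        pointwise (yes ox) = pairs-own (λ _ → 0) ox
        pointwise (no ¬ox) = pairs-foreign (λ _ → 0) ¬ox
      vacancies≡ : vacancies (λ _ → 0) ≡ suc (h + h)
      vacancies≡ = +-cancelˡ-≡ (lookup a (proj₁ r)) _ _ (trans part+vacancies-empty sum≡)
    small-configurations-odd h sum≡ {w} ¬ow (suc s) s< =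
      let s≤ = s≤s⁻¹ (s≤s⁻¹ (≤-trans s< (≤-reflexive
                 (trans (cong (λ n → n + suc (h + h) + 2) sum≡) (regroup (lookup a (proj₁ r)) h)))))
          C , size≡ , loses = deploy s s≤
      in C , trans size≡ (cong (_+ s) (size-point w 1)) , loses
      where
      regroup : ∀ l h → l + suc (h + h) + suc (h + h) + 2 ≡ 2 + (l + (h + h + (h + h)) + 2)
      regroup = solve-∀
      point≤1 : ∀ x → Dec (x ≡ w) → point w 1 x ≤ 1
      point≤1 x (yes refl) = ≤-reflexive (point-self w 1)
      point≤1 x (no x≢w)   = subst (_≤ 1) (sym (point-other 1 x≢w)) z≤n
      open Deployment h (point w 1) (λ ox → point-other 1 (own≢foreign ox ¬ow))
        (λ x → point≤1 x (decV a x w))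
        (trans (cong (λ c → c + (h + h) + lookup a (proj₁ r)) (size-point w 1))
               (trans (+-comm (suc (h + h)) _) (sym sum≡)))

-- The additive constant and the maximum over all roots.

data Offset : ℕ → ℕ → Set where
  even : ∀ h → Offset (h + h) 3
  odd  : ∀ h → Offset (suc (h + h)) 2

offset : ∀ n → ∃[ k ] Offset n k
offset n with even-or-odd n
... | inj₁ (h , refl) = 3 , even h
... | inj₂ (h , refl) = 2 , odd h

double≢suc-double : ∀ m n → m + m ≢ suc (n + n)
double≢suc-double (suc m) n eq =
  double≢suc-double n m (sym (trans (sym (+-suc m m)) (suc-injective eq)))

2≤offset : ∀ {n k} → Offset n k → 2 ≤ k
2≤offset (even _) = s≤s (s≤s z≤n)
2≤offset (odd _)  = s≤s (s≤s z≤n)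

offset≤3 : ∀ {n k} → Offset n k → k ≤ 3
offset≤3 (even _) = ≤-refl
offset≤3 (odd _)  = n≤1+n 2

offset-even : ∀ {n k} → Offset n k → ∀ h → n ≡ h + h → k ≡ 3
offset-even (even _) _ _ = refl
offset-even (odd h') h eq = contradiction (sym eq) (double≢suc-double h h')

offset-odd : ∀ {n k} → Offset n k → ∀ h → n ≡ suc (h + h) → k ≡ 2
offset-odd (odd _) _ _ = refl
offset-odd (even h') h eq = contradiction eq (double≢suc-double h' h)

-- The constants differ by at most one, so a drop from 3 to 2 is made up by the growth of N. Hence a
-- smaller root part never gives a smaller rooted number.
offset-mono : ∀ {m n j k} → Offset m j → Offset n k → m ≤ n → m + j ≤ n + k
offset-mono {m} {n} {j} {k} om on m≤n with m≤n⇒m<n∨m≡n m≤n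
... | inj₁ m<n = ≤-trans (+-monoʳ-≤ m (offset≤3 om))
                   (≤-trans (≤-reflexive (+-suc m 2)) (+-mono-≤ m<n (2≤offset on)))
... | inj₂ refl = +-monoʳ-≤ m (≤-reflexive (unique om))
  where
  unique : ∀ {j} → Offset n j → j ≡ k
  unique (even h) = sym (offset-even on h refl)
  unique (odd h)  = sym (offset-odd on h refl)

-- Mover wins at every size from the threshold on, so the threshold also serves as the bound that
-- excludes an infinite value.
rooted-number : ∀ {m} (a : Vec ℕ m) (r : Vertex a) → 3 ≤ lookup a (proj₁ r) →
  ∀ {N K} → 1 ≤ N → sum a ≡ lookup a (proj₁ r) + N → Offset N K → EtaRootIs a r (sum a + N + K)
rooted-number a r 3≤ {N} {K} 1≤N sum≡ o =
  (λ C size≡ → wins C (≤-reflexive (sym size≡))) , small o sum≡ , (sum a + N + K , wins)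
  where
  open Game a r
  -- The empty configuration has N ≥ 1 vacancies, which provides a vertex outside the root's part.
  outside : ∃[ v ] (¬ Own v × 0 ≡ 0)
  outside = find-vacant {λ _ → 0} (subst (1 ≤_)
    (sym (+-cancelˡ-≡ (lookup a (proj₁ r)) _ _ (trans part+vacancies-empty sum≡))) 1≤N)
  mate : ∀ {u} → Own u → ∃[ y ] (Own y × y ≢ r × y ≢ u)
  mate {_ , j} (own refl) with s , s≢r , s≢j ← fresh 3≤ (proj₂ r) j =
    (proj₁ r , s) , own refl , (λ { refl → s≢r refl }) , (λ { refl → s≢j refl })
  open Mover (proj₁ outside) (proj₁ (proj₂ outside))
  open Defender mate
  wins : ∀ C → sum a + N + K ≤ size a C → MoverTurn a r C
  wins = large-configurations-win N K sum≡ (2≤offset o)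
    λ h eq → ≤-reflexive (sym (offset-even o h eq))
  small : ∀ {N K} → Offset N K → sum a ≡ lookup a (proj₁ r) + N →
    ∀ s → s < sum a + N + K → ∃[ C ] (size a C ≡ s × ¬ MoverTurn a r C)
  small (even h) sum≡ = small-configurations-even h sum≡
  small (odd h)  sum≡ = small-configurations-odd h sum≡ (proj₁ (proj₂ outside))

last≡lookup : ∀ {k} (xs : Vec A (suc k)) → last xs ≡ lookup xs (fromℕ k)
last≡lookup (x ∷ [])     = refl
last≡lookup (x ∷ y ∷ ys) = last≡lookup (y ∷ ys)

-- The maximum is attained at a root in the first, smallest part, where n + N is 2n - a₁. Sortedness
-- and `last a < sum a` give every root a non-empty complement of its part.
eta : ∀ k (a : Vec ℕ (suc k)) → 3 ≤ head a → Sorted a → last a < sum a →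
  ∀ {K} → Offset (sum a ∸ head a) K → EtaIs a (2 * sum a ∸ head a + K)
eta k a@(a₁ ∷ _) 3≤a₁ sorted last<sum {K} o =
  (λ r → let K' , o' = offset (sum a ∸ part r) in
    sum a + (sum a ∸ part r) + K' ,
    (begin
      sum a + (sum a ∸ part r) + K'    ≡⟨ +-assoc (sum a) _ K' ⟩
      sum a + (sum a ∸ part r + K')    ≤⟨ +-monoʳ-≤ (sum a)
                                            (offset-mono o' o (∸-monoʳ-≤ (sum a) (a₁≤ r))) ⟩
      sum a + (sum a ∸ a₁ + K)         ≡⟨ +-assoc (sum a) _ K ⟨
      sum a + (sum a ∸ a₁) + K         ≡⟨ value ⟩
      2 * sum a ∸ a₁ + K               ∎) ,
    rooted r o') ,
  first , subst (EtaRootIs a first) value (rooted first o)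
  where
  open ≤-Reasoning
  part : Vertex a → ℕ
  part r = lookup a (proj₁ r)
  a₁≤ : ∀ r → a₁ ≤ part r
  a₁≤ r = sorted zero (proj₁ r) z≤n
  part<sum : ∀ r → part r < sum a
  part<sum r = ≤-<-trans (sorted (proj₁ r) (fromℕ k) (FinP.≤fromℕ (proj₁ r)))
                         (subst (_< sum a) (last≡lookup a) last<sum)
  rooted : ∀ r {K} → Offset (sum a ∸ part r) K → EtaRootIs a r (sum a + (sum a ∸ part r) + K)
  rooted r = rooted-number a r (≤-trans 3≤a₁ (a₁≤ r)) (m<n⇒0<n∸m (part<sum r))
    (sym (m+[n∸m]≡n (<⇒≤ (part<sum r))))
  first : Vertex a
  first = zero , fromℕ< (≤-trans (s≤s z≤n) 3≤a₁)
  value : sum a + (sum a ∸ a₁) + K ≡ 2 * sum a ∸ a₁ + K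
  value = cong (_+ K) (trans
    (sym (+-∸-assoc (sum a) (<⇒≤ (part<sum first))))
    (cong (λ s → sum a + s ∸ a₁) (sym (+-identityʳ (sum a)))))

theorem3p22 : (k : ℕ) (a : Vec ℕ (ℕ.suc k)) →
    3 ≤ head a → Sorted a → last a < sum a →
    (2 ∣ (sum a ∸ head a) → EtaIs a (2 * sum a ∸ head a + 3)) ×
    (¬ (2 ∣ (sum a ∸ head a)) → EtaIs a (2 * sum a ∸ head a + 2))
theorem3p22 k a 3≤ sorted last< = on-even , on-odd
  where
  halve : ∀ h → h * 2 ≡ h + h
  halve = solve-∀
  on-even : 2 ∣ (sum a ∸ head a) → EtaIs a (2 * sum a ∸ head a + 3)
  on-even (divides h eq) = eta k a 3≤ sorted last<
    (subst (λ n → Offset n 3) (sym (trans eq (halve h))) (even h))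
  on-odd : ¬ (2 ∣ (sum a ∸ head a)) → EtaIs a (2 * sum a ∸ head a + 2)
  on-odd 2∤ with even-or-odd (sum a ∸ head a)
  ... | inj₁ (h , eq) = contradiction (divides h (trans eq (sym (halve h)))) 2∤
  ... | inj₂ (h , eq) = eta k a 3≤ sorted last< (subst (λ n → Offset n 2) (sym eq) (odd h))
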